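{- The $\mathbb{K}$-linear span $\mathbf{FSym}$ of the elements $\mathbf{S}_t$, $t$ running over standard Young tableaux of all sizes $n\ge1$, is stable under the $\#$ product: for any standard tableaux $t',t''$, $\mathbf{S}_{t'}\#\mathbf{S}_{t''}$ is a linear combination of elements $\mathbf{S}_t$.
   Context: Let $A=\{a_1<a_2<\cdots\}$ be an infinite totally ordered alphabet and $\mathbb{K}$ a field; work with formal $\mathbb{K}$-linear combinations of nonempty words over $A$. The $\#$ product of words is $(ux)\#(yv)=uxv$ if the letters $x,y$ are equal and $0$ otherwise ($u,v$ words, $x,y$ letters), extended bilinearly. $\mathrm{std}(w)$ is the standardization of a word (number left to right the occurrences of the smallest letter $1,2,\dots$, then those of the next letter, etc.), $\mathbf{G}_\sigma=\sum_{\mathrm{std}(w)=\sigma}w$ and $\mathbf{F}_\sigma=\mathbf{G}_{\sigma^{ -1}}$. For a permutation $\sigma$, $P(\sigma)$ denotes its insertion tableau (P-symbol) under the Robinson–Schensted correspondence. For a standard tableau $t$, $\mathbf{S}_t=\sum_{P(\sigma)=t}\mathbf{F}_\sigma$. -}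

module Defs where

open import Level using (Level; _⊔_; suc)
open import Algebra.Bundles using (CommutativeRing)
open import Data.Nat as ℕ using (ℕ; zero; _<_; _<?_; _≟_)
import Data.Nat as Nat
open import Data.List using (List; []; _∷_; [_]; _++_; length; filter; map; foldl; foldr; concatMap; concat; take; drop; upTo)
open import Data.Nat.ListAction using (sum)
open import Data.List.Properties using (≡-dec)
open import Data.List.Relation.Binary.Permutation.Propositional using (_↭_)
open import Data.List.Relation.Unary.All using (All)
open import Data.Maybe using (Maybe; just; nothing)
open import Data.Product using (_×_; _,_; proj₁; proj₂; Σ; ∃)
open import Relation.Nullary using (¬_; yes; no; Dec)
open import Relation.Binary.PropositionalEquality using (_≡_)

record Field (c ℓ : Level) : Set (Level.suc (c ⊔ ℓ)) where
  field
    commutativeRing : CommutativeRing c ℓ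
  open CommutativeRing commutativeRing public
  field
    1≉0     : ¬ (1# ≈ 0#)
    mulInverse : ∀ x → ¬ (x ≈ 0#) → Σ Carrier (λ y → (x * y) ≈ 1#)

-- Words over the alphabet A = {a₁ < a₂ < ...}, identified with ℕ
-- (letter aᵢ ↦ i) with its usual order.

Word : Set
Word = List ℕ

-- Permutations are written in one-line notation as words over 1..n.

countLess : ℕ → Word → ℕ
countLess x w = length (filter (λ y → y <? x) w)

countEq : ℕ → Word → ℕ
countEq x w = length (filter (λ y → y ≟ x) w)

-- Standardization: the occurrence of letter x at position i receives
-- label (#letters of w smaller than x) + (#occurrences of x strictly
-- left of i) + 1, i.e. occurrences of the smallest letter are numbered
-- 1,2,... from left to right, then those of the next letter, etc.
stdAux : Word → Word → Word → Word
stdAux w prefix []       = []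
stdAux w prefix (x ∷ xs) =
  Nat.suc (countLess x w Nat.+ countEq x prefix) ∷ stdAux w (prefix ++ [ x ]) xs

std : Word → Word
std w = stdAux w [] w

position : ℕ → Word → ℕ
position k []       = 0
position k (x ∷ xs) with k ≟ x
... | yes _ = 1
... | no  _ = Nat.suc (position k xs)

oneTo : ℕ → List ℕ
oneTo n = map Nat.suc (upTo n)

inverse : Word → Word
inverse σ = map (λ k → position k σ) (oneTo (length σ))

insertions : ℕ → List ℕ → List (List ℕ)
insertions x []       = [ [ x ] ]
insertions x (y ∷ ys) = (x ∷ y ∷ ys) ∷ map (y ∷_) (insertions x ys)

perms : ℕ → List Word
perms zero        = [ [] ]
perms (Nat.suc n) = concatMap (insertions (Nat.suc n)) (perms n)

-- Tableaux (English convention: list of rows, top row first)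

Tableau : Set
Tableau = List (List ℕ)

size : Tableau → ℕ
size t = sum (map length t)

data RowIncr : List ℕ → Set where
  nil : RowIncr []
  single : ∀ x → RowIncr [ x ]
  cons : ∀ {x y ys} → x < y → RowIncr (y ∷ ys) → RowIncr (x ∷ y ∷ ys)

data ColsBelow : List ℕ → List ℕ → Set where
  nil : ∀ {r} → ColsBelow r []
  cons : ∀ {x y xs ys} → x < y → ColsBelow xs ys → ColsBelow (x ∷ xs) (y ∷ ys)

data ColsIncr : Tableau → Set where
  nil : ColsIncr []
  single : ∀ r → ColsIncr [ r ]
  cons : ∀ {r₁ r₂ rs} → ColsBelow r₁ r₂ → ColsIncr (r₂ ∷ rs) → ColsIncr (r₁ ∷ r₂ ∷ rs)

-- A standard Young tableau of size n ≥ 1: nonempty rows of weakly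
-- decreasing lengths (encoded in ColsBelow), rows and columns strictly
-- increasing, entries exactly 1..n each once.
record IsStandard (t : Tableau) : Set where
  field
    rowsNonempty : All (λ r → 1 Nat.≤ length r) t
    rowsIncr     : All RowIncr t
    colsIncr     : ColsIncr t
    entries      : concat t ↭ oneTo (size t)
    sizePos      : 1 Nat.≤ size t

rowInsert : ℕ → List ℕ → Maybe ℕ × List ℕ
rowInsert x []       = nothing , [ x ]
rowInsert x (y ∷ ys) with x <? y
... | yes _ = just y , x ∷ ys
... | no  _ = let r = rowInsert x ys in proj₁ r , y ∷ proj₂ r

insertRS : ℕ → Tableau → Tableau
insertRS x []       = [ [ x ] ]
insertRS x (r ∷ rs) with rowInsert x r
... | nothing , r' = r' ∷ rs
... | just y  , r' = r' ∷ insertRS y rs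

P : Word → Tableau
P σ = foldl (λ t x → insertRS x t) [] σ

-- Formal (possibly infinite) K-linear combinations of words, as
-- coefficient functions; series over a field.

module Series {c ℓ} (K : Field c ℓ) where
  open Field K

  Ser : Set c
  Ser = Word → Carrier

  Σ-list : List Carrier → Carrier
  Σ-list = foldr _+_ 0#

  -- # product: (ux)#(yv) = uxv if x = y, else 0, extended bilinearly.
  -- Coefficient of w = u x v is Σ over positions i of x in w of
  -- f(ux) · g(xv), where ux = take (i+1) w and xv = drop i w.
  _#_ : Ser → Ser → Ser
  (f # g) w = Σ-list (map (λ i → f (take (Nat.suc i) w) * g (drop i w)) (upTo (length w)))

  G : Word → Ser
  G σ w with ≡-dec _≟_ (std w) σ
  ... | yes _ = 1#
  ... | no  _ = 0#

  F : Word → Ser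
  F σ = G (inverse σ)

  indicatorP : Tableau → Word → Carrier
  indicatorP t σ with ≡-dec (≡-dec _≟_) (P σ) t
  ... | yes _ = 1#
  ... | no  _ = 0#

  S : Tableau → Ser
  S t w = Σ-list (map (λ σ → indicatorP t σ * F σ w) (perms (size t)))

  combS : List (Carrier × Tableau) → Ser
  combS cs w = Σ-list (map (λ p → proj₁ p * S (proj₂ p) w) cs)

  InFSym : Ser → Set (c ⊔ ℓ)
  InFSym f = ∃ λ (cs : List (Carrier × Tableau)) →
               All (λ p → IsStandard (proj₂ p)) cs × (∀ w → f w ≈ combS cs w)

{-# OPTIONS --safe #-}
module Submission where

-- S_t is the sum of the words w whose standardization has an inverse with insertion tableau t; that inverse
-- lists the positions of w, sorted stably by letter. For a factor of w it is the restriction of the list for w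
-- to an interval of positions (up to a shift). A permutation is Knuth equivalent to the reading word of its
-- insertion tableau, Knuth equivalence survives restriction to an interval of letters, and equivalent words have
-- the same insertion tableau. Hence the coefficient of w in a # product of two S's depends only on the insertion
-- tableau attached to w.

open import Defs
open import Level using (Level)
open import Data.List
  using (List; []; _∷_; [_]; _++_; length; map; foldl; concat; filter; upTo; applyUpTo; take; drop;
         deduplicate; fromMaybe)
open import Data.List.Membership.Propositional using (_∈_; find)
open import Data.List.Membership.Propositional.Properties
open import Data.List.Properties
import Data.List.Relation.Binary.Permutation.Propositional.Properties as Perm
open import Data.List.Relation.Binary.Disjoint.Propositional using (Disjoint)
open import Data.List.Relation.Binary.Permutation.Propositional
  using (_↭_; ↭-refl; ↭-sym; ↭-trans; ↭-reflexive; prep; swap; ↭⇒↭ₛ)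
open import Data.List.Relation.Unary.All as All using (All; []; _∷_)
import Data.List.Relation.Unary.All.Properties as All
open import Data.List.Relation.Unary.AllPairs using (AllPairs; []; _∷_)
import Data.List.Relation.Unary.AllPairs.Properties as AllPairs
open import Data.List.Relation.Unary.Any as Any using (here; there)
import Data.List.Relation.Unary.Unique.DecPropositional.Properties as DecUnique
open import Data.List.Relation.Unary.Unique.Propositional using (Unique)
import Data.List.Relation.Unary.Unique.Propositional.Properties as Unique
open import Data.Maybe as Maybe using (Maybe; just; nothing)
open import Data.Nat using (ℕ; zero; suc; pred; _+_; _≤_; _<_; _<?_; _≤?_; _≟_; z≤n; s≤s; >-nonZero)
open import Data.Nat.Properties
  using (+-cancelˡ-≡; +-comm; +-identityʳ; +-monoʳ-<; +-monoʳ-≤; +-suc; <-cmp; <-trans; <-≤-trans; <⇒≢;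
         <⇒≤; <⇒≯; <⇒≱; >⇒≢; m+[n∸m]≡n; m<m+n; m≤m+n; m≤n+m; m≤n⇒m⊓n≡m; n≤1+n; n≮n; suc-injective;
         suc-pred; ≤-<-trans; ≤-refl; ≤-trans; ≤⇒≯; ≤∧≢⇒<; ≮⇒≥; ≰⇒>)
open import Data.Product using (_×_; _,_; proj₁; proj₂; ∃; ∃₂)
open import Data.Sum using (_⊎_; inj₁; inj₂)
open import Function using (_∘_; id)
open import Relation.Binary using (DecidableEquality; tri<; tri≈; tri>)
import Relation.Binary.Construct.Closure.Equivalence as Eq
open import Relation.Binary.PropositionalEquality hiding ([_])
open import Relation.Nullary using (¬_; yes; no; Dec; contradiction)
open import Relation.Nullary.Decidable using (¬?)
open import Relation.Unary using (Pred; Decidable)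

-- Row insertion

-- A restricted word need not be a permutation of an initial segment: the second factor leaves the
-- letters from `j + 1` on. Row insertion and Knuth equivalence are therefore treated for arbitrary
-- words, with weakly increasing rows, so that distinctness of letters need not be carried through
-- the bumping arguments. Strictness is recovered from distinctness only when insertion tableaux of
-- permutations have to be standard. Although the series are infinite, a finite combination
-- suffices: `S t` is supported on words of length `size t`, and the two factors share one letter,
-- so only tableaux of size `size t′ + size t″ - 1` occur. The coefficient of `S t` is evaluated on
-- the reading word of `t`, a representative of the Knuth class that is computed from `t` alone; as
-- a product of two indicators it is 0 or 1.

data RowInsertion (x : ℕ) : List ℕ → Maybe ℕ → List ℕ → Set where
  append : RowInsertion x [] nothing [ x ]
  bump   : ∀ {y r} → x < y → RowInsertion x (y ∷ r) (just y) (x ∷ r)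
  skip   : ∀ {y r m r′} → y ≤ x → RowInsertion x r m r′ → RowInsertion x (y ∷ r) m (y ∷ r′)

rowInsertion : ∀ x r → RowInsertion x r (proj₁ (rowInsert x r)) (proj₂ (rowInsert x r))
rowInsertion x []      = append
rowInsertion x (y ∷ r) with x <? y
... | yes x<y = bump x<y
... | no  x≮y = skip (≮⇒≥ x≮y) (rowInsertion x r)

-- Identifies the relation with the graph of `rowInsert`. Several successive insertions can then be
-- analysed by matching on derivations, with impossible combinations refuted by the order.
rowInsert-complete : ∀ {x r m r′} → RowInsertion x r m r′ → rowInsert x r ≡ (m , r′)
rowInsert-complete append = refl
rowInsert-complete {x} {y ∷ _} (bump x<y) with x <? y
... | yes _   = refl
... | no  x≮y = contradiction x<y x≮y
rowInsert-complete {x} {y ∷ _} (skip y≤x i) with x <? y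
... | yes x<y = contradiction x<y (≤⇒≯ y≤x)
... | no  _ rewrite rowInsert-complete i = refl

insertRS? : Maybe ℕ → Tableau → Tableau
insertRS? nothing  t = t
insertRS? (just x) t = insertRS x t

insertRS-∷ : ∀ {x r m r′} rs → RowInsertion x r m r′ → insertRS x (r ∷ rs) ≡ r′ ∷ insertRS? m rs
insertRS-∷ {x} {r} rs i with rowInsert x r | rowInsert-complete i
... | nothing , _ | refl = refl
... | just _  , _ | refl = refl

WeakRow : List ℕ → Set
WeakRow = AllPairs _≤_

module _ {p} {Q : Pred ℕ p} where

  rowInsertion-All : ∀ {x r m r′} → RowInsertion x r m r′ → Q x → All Q r → All Q r′
  rowInsertion-All append     qx _        = qx ∷ []
  rowInsertion-All (bump _)   qx (_ ∷ qs) = qx ∷ qs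
  rowInsertion-All (skip _ i) qx (q ∷ qs) = q ∷ rowInsertion-All i qx qs

  bumped-All : ∀ {x r y r′} → RowInsertion x r (just y) r′ → All Q r → Q y
  bumped-All (bump _)   (q ∷ _)  = q
  bumped-All (skip _ i) (_ ∷ qs) = bumped-All i qs

bumped-> : ∀ {x r y r′} → RowInsertion x r (just y) r′ → x < y
bumped-> (bump x<y) = x<y
bumped-> (skip _ i) = bumped-> i

rowInsertion-weak : ∀ {x r m r′} → RowInsertion x r m r′ → WeakRow r → WeakRow r′
rowInsertion-weak append       _        = [] ∷ []
rowInsertion-weak (bump x<y)   (p ∷ ps) = All.map (≤-trans (<⇒≤ x<y)) p ∷ ps
rowInsertion-weak (skip y≤x i) (p ∷ ps) = rowInsertion-All i y≤x p ∷ rowInsertion-weak i ps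

WeakTableau : Tableau → Set
WeakTableau = All WeakRow

insertRS-weak : ∀ x t → WeakTableau t → WeakTableau (insertRS x t)
insertRS?-weak : ∀ m t → WeakTableau t → WeakTableau (insertRS? m t)
insertRS-weak x []      _        = ([] ∷ []) ∷ []
insertRS-weak x (r ∷ t) (w ∷ ws)
  rewrite insertRS-∷ t (rowInsertion x r) =
  rowInsertion-weak (rowInsertion x r) w ∷ insertRS?-weak (proj₁ (rowInsert x r)) t ws
insertRS?-weak nothing  t ws = ws
insertRS?-weak (just x) t ws = insertRS-weak x t ws

-- Bumped letters are compared with nothing read as ∞.

data _≤∞_ : Maybe ℕ → Maybe ℕ → Set where
  ≤-∞    : ∀ {m} → m ≤∞ nothing
  ≤-just : ∀ {x y} → x ≤ y → just x ≤∞ just y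

data _<∞_ : Maybe ℕ → Maybe ℕ → Set where
  <-∞    : ∀ {x} → just x <∞ nothing
  <-just : ∀ {x y} → x < y → just x <∞ just y

-- After `y` has entered, `z` passes it and acts strictly further right, where the weakly increasing
-- row has only entries that are at least the one bumped by `y`.
bumped-≤ : ∀ {y z r m r₁ n r₂} → y ≤ z → WeakRow r →
           RowInsertion y r m r₁ → RowInsertion z r₁ n r₂ → m ≤∞ n
bumped-≤ y≤z w append (bump z<y) = contradiction z<y (≤⇒≯ y≤z)
bumped-≤ y≤z w append (skip _ append) = ≤-∞
bumped-≤ y≤z w (bump _) (bump z<y) = contradiction z<y (≤⇒≯ y≤z)
bumped-≤ {n = nothing} y≤z w (bump _) (skip _ j) = ≤-∞
bumped-≤ {n = just _} y≤z (p ∷ _) (bump _) (skip _ j) = ≤-just (bumped-All j p)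
bumped-≤ y≤z w (skip a≤y i) (bump z<a) = contradiction (<-≤-trans z<a a≤y) (≤⇒≯ y≤z)
bumped-≤ y≤z (_ ∷ w) (skip _ i) (skip _ j) = bumped-≤ y≤z w i j

-- Once `z` is in the row, `y` cannot pass it. So `y` does bump a letter, namely `z` or an entry
-- that `z` has passed, while `z` bumped something larger than itself.
bumped-< : ∀ {y z r m r₁ n r₂} → y < z →
           RowInsertion z r m r₁ → RowInsertion y r₁ n r₂ → n <∞ m
bumped-< y<z append (bump _) = <-∞
bumped-< y<z append (skip z≤y _) = contradiction y<z (≤⇒≯ z≤y)
bumped-< y<z (bump z<a) (bump _) = <-just z<a
bumped-< y<z (bump _) (skip z≤y _) = contradiction y<z (≤⇒≯ z≤y)
bumped-< {m = nothing} y<z (skip _ i) (bump y<a) = <-∞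
bumped-< {m = just _} y<z (skip a≤z i) (bump y<a) = <-just (≤-<-trans a≤z (bumped-> i))
bumped-< y<z (skip _ i) (skip _ j) = bumped-< y<z i j

-- In the row that contains `y`, the letter `x` acts in the cell of `y` or to its left and `z`
-- strictly to its right, so these two insertions do not interfere.
commute₁ : ∀ {x y z r m₁ r₁ m₂ r₂ m₃ r₃} → x < y → y ≤ z →
  RowInsertion y r m₁ r₁ → RowInsertion z r₁ m₂ r₂ → RowInsertion x r₂ m₃ r₃ →
  ∃ λ s → RowInsertion x r₁ m₃ s × RowInsertion z s m₂ r₃
commute₁ x<y y≤z append (bump z<y) k = contradiction z<y (≤⇒≯ y≤z)
commute₁ x<y y≤z append (skip _ append) (bump x<y′) =
  _ , bump x<y , skip (<⇒≤ (<-≤-trans x<y y≤z)) append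
commute₁ x<y y≤z append (skip _ append) (skip y≤x _) = contradiction x<y (≤⇒≯ y≤x)
commute₁ x<y y≤z (bump _) (bump z<y) k = contradiction z<y (≤⇒≯ y≤z)
commute₁ x<y y≤z (bump _) (skip _ j) (bump _) =
  _ , bump x<y , skip (<⇒≤ (<-≤-trans x<y y≤z)) j
commute₁ x<y y≤z (bump _) (skip _ j) (skip y≤x _) = contradiction x<y (≤⇒≯ y≤x)
commute₁ x<y y≤z (skip a≤y i) (bump z<a) k = contradiction (<-≤-trans z<a a≤y) (≤⇒≯ y≤z)
commute₁ x<y y≤z (skip _ i) (skip _ j) (bump x<a) =
  _ , bump x<a , skip (<⇒≤ (<-≤-trans x<y y≤z)) j
commute₁ x<y y≤z (skip _ i) (skip a≤z j) (skip a≤x k)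
  with _ , k′ , j′ ← commute₁ x<y y≤z i j k = _ , skip a≤x k′ , skip a≤z j′

-- The second alternative arises when z is smaller than the letter bumped by x: then the three bumped letters
-- form a triple of the other Knuth relation.
commute₂ : ∀ {x y z r m₁ r₁ m₂ r₂ m₃ r₃} → x ≤ y → y < z → WeakRow r →
  RowInsertion x r m₁ r₁ → RowInsertion z r₁ m₂ r₂ → RowInsertion y r₂ m₃ r₃ →
  (∃ λ s → RowInsertion z r m₂ s × RowInsertion x s m₁ r₂) ⊎
  (∃₂ λ s s′ → RowInsertion z r m₁ s × RowInsertion x s m₃ s′ × RowInsertion y s′ m₂ r₃)
commute₂ x≤y y<z w append (bump z<x) k = contradiction (<-≤-trans z<x x≤y) (<⇒≯ y<z)
commute₂ x≤y y<z w append (skip _ append) (bump y<x) = contradiction y<x (≤⇒≯ x≤y)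
commute₂ x≤y y<z w append (skip _ append) (skip _ (bump _)) =
  inj₂ (_ , _ , append , bump (≤-<-trans x≤y y<z) , skip x≤y append)
commute₂ x≤y y<z w append (skip _ append) (skip _ (skip z≤y _)) = contradiction y<z (≤⇒≯ z≤y)
commute₂ x≤y y<z w (bump _) (bump z<x) k = contradiction (<-≤-trans z<x x≤y) (<⇒≯ y<z)
-- If `a ≤ z`, then `z` passes this cell whether it holds `a` or `x`, and the two insertions
-- commute. If `z < a`, then `z` enters the cell just after `x` in one order and the cell of `a`
-- itself in the other.
commute₂ {z = z} x≤y y<z w (bump {a} x<a) (skip x≤z j) k with z <? a
commute₂ x≤y y<z w (bump {a} x<a) (skip x≤z j) k | no z≮a =
  inj₁ (_ , skip (≮⇒≥ z≮a) j , bump x<a)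
commute₂ x≤y y<z w (bump x<a) (skip _ j) (bump y<x) | yes _ = contradiction y<x (≤⇒≯ x≤y)
commute₂ x≤y y<z w (bump x<a) (skip x≤z append) (skip _ (bump _)) | yes z<a =
  inj₂ (_ , _ , bump z<a , bump (≤-<-trans x≤y y<z) , skip x≤y append)
commute₂ x≤y y<z w (bump x<a) (skip x≤z append) (skip _ (skip z≤y _)) | yes z<a =
  contradiction y<z (≤⇒≯ z≤y)
commute₂ x≤y y<z w (bump x<a) (skip x≤z (bump z<b)) (skip _ (bump _)) | yes z<a =
  inj₂ (_ , _ , bump z<a , bump (≤-<-trans x≤y y<z) , skip x≤y (bump (<-trans y<z z<b)))
commute₂ x≤y y<z w (bump x<a) (skip x≤z (bump z<b)) (skip _ (skip z≤y _)) | yes z<a =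
  contradiction y<z (≤⇒≯ z≤y)
commute₂ x≤y y<z ((a≤b ∷ _) ∷ _) (bump x<a) (skip x≤z (skip b≤z j)) k | yes z<a =
  contradiction (<-≤-trans z<a a≤b) (≤⇒≯ b≤z)
commute₂ x≤y y<z w (skip a≤x i) (bump z<a) k =
  contradiction (<-≤-trans z<a (≤-trans a≤x x≤y)) (<⇒≯ y<z)
commute₂ x≤y y<z w (skip a≤x i) (skip a≤z j) (bump y<a) =
  contradiction (<-≤-trans y<a a≤x) (≤⇒≯ x≤y)
commute₂ x≤y y<z (_ ∷ w) (skip a≤x i) (skip a≤z j) (skip a≤y k) with commute₂ x≤y y<z w i j k
... | inj₁ (_ , j′ , i′) = inj₁ (_ , skip a≤z j′ , skip a≤x i′)
... | inj₂ (_ , _ , j′ , i′ , k′) = inj₂ (_ , _ , skip a≤z j′ , skip a≤x i′ , skip a≤y k′)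

insertRS³-∷ : ∀ {a b c r m₁ r₁ m₂ r₂ m₃ r₃} t →
  RowInsertion a r m₁ r₁ → RowInsertion b r₁ m₂ r₂ → RowInsertion c r₂ m₃ r₃ →
  insertRS c (insertRS b (insertRS a (r ∷ t))) ≡
  r₃ ∷ insertRS? m₃ (insertRS? m₂ (insertRS? m₁ t))
insertRS³-∷ {m₁ = m₁} {m₂ = m₂} t i j k
  rewrite insertRS-∷ t i | insertRS-∷ (insertRS? m₁ t) j
        | insertRS-∷ (insertRS? m₂ (insertRS? m₁ t)) k = refl

-- Descends row by row: the bumped letters form a triple of the same kind for the rows below. If the
-- largest of them is absent, both sides perform the same insertions there.
insertRS-knuth₁ : ∀ {x y z} t → x < y → y ≤ z → WeakTableau t →
  insertRS x (insertRS z (insertRS y t)) ≡ insertRS z (insertRS x (insertRS y t))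
insertRS?-knuth₁ : ∀ {m₁ m₂ m₃} t → m₃ <∞ m₁ → m₁ ≤∞ m₂ → WeakTableau t →
  insertRS? m₃ (insertRS? m₂ (insertRS? m₁ t)) ≡ insertRS? m₂ (insertRS? m₃ (insertRS? m₁ t))

insertRS-knuth₁ [] x<y y≤z w = trans
  (insertRS³-∷ [] append (skip y≤z append) (bump x<y))
  (sym (insertRS³-∷ [] append (bump x<y) (skip (<⇒≤ (<-≤-trans x<y y≤z)) append)))
insertRS-knuth₁ {x} {y} {z} (r ∷ t) x<y y≤z (w ∷ ws)
  with i ← rowInsertion y r
  with j ← rowInsertion z (proj₂ (rowInsert y r))
  with k ← rowInsertion x (proj₂ (rowInsert z (proj₂ (rowInsert y r))))
  with _ , k′ , j′ ← commute₁ x<y y≤z i j k = trans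
  (insertRS³-∷ t i j k)
  (trans (cong (_ ∷_) (insertRS?-knuth₁ t (bumped-< x<y i k′) (bumped-≤ y≤z w i j) ws))
         (sym (insertRS³-∷ t i k′ j′)))

insertRS?-knuth₁ t _            ≤-∞        ws = refl
insertRS?-knuth₁ t (<-just x<y) (≤-just y≤z) ws = insertRS-knuth₁ t x<y y≤z ws

-- Here the kind of the triple may change from one row to the next. It can only change to the first
-- kind, which persists by `insertRS-knuth₁`.
insertRS-knuth₂ : ∀ {x y z} t → x ≤ y → y < z → WeakTableau t →
  insertRS y (insertRS z (insertRS x t)) ≡ insertRS y (insertRS x (insertRS z t))
insertRS?-knuth₂ : ∀ {m₁ m₂ m₃} t → m₁ ≤∞ m₃ → m₃ <∞ m₂ → WeakTableau t →
  insertRS? m₃ (insertRS? m₂ (insertRS? m₁ t)) ≡ insertRS? m₃ (insertRS? m₁ (insertRS? m₂ t))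

insertRS-knuth₂ [] x≤y y<z w = trans
  (insertRS³-∷ [] append (skip (<⇒≤ (≤-<-trans x≤y y<z)) append) (skip x≤y (bump y<z)))
  (sym (insertRS³-∷ [] append (bump (≤-<-trans x≤y y<z)) (skip x≤y append)))
insertRS-knuth₂ {x} {y} {z} (r ∷ t) x≤y y<z (w ∷ ws)
  with i ← rowInsertion x r
  with j ← rowInsertion z (proj₂ (rowInsert x r))
  with k ← rowInsertion y (proj₂ (rowInsert z (proj₂ (rowInsert x r))))
  with commute₂ x≤y y<z w i j k
... | inj₁ (_ , j′ , i′) = trans
  (insertRS³-∷ t i j k)
  -- Each comparison is read off an order in which the two letters are inserted consecutively: `x`,
  -- `y` in the order z, x, y, and `z`, `y` in the order x, z, y.
  (trans (cong (_ ∷_) (insertRS?-knuth₂ t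
           (bumped-≤ x≤y (rowInsertion-weak j′ w) i′ k) (bumped-< y<z j k) ws))
         (sym (insertRS³-∷ t j′ i′ k)))
... | inj₂ (_ , _ , j′ , i′ , k′) = trans
  (insertRS³-∷ t i j k)
  (trans (cong (_ ∷_) (insertRS?-knuth₁ t
           (bumped-< x<z j′ i′) (bumped-≤ (<⇒≤ x<z) w i j) ws))
         (sym (insertRS³-∷ t j′ i′ k′)))
  where x<z = ≤-<-trans x≤y y<z

insertRS?-knuth₂ t _            <-∞          ws = refl
insertRS?-knuth₂ t (≤-just x≤y) (<-just y<z) ws = insertRS-knuth₂ t x≤y y<z ws

-- Knuth equivalence

infix 4 _⟶_ _∼_

data _⟶_ : Word → Word → Set where
  knuth₁ : ∀ {x y z u} → x < y → y ≤ z → y ∷ z ∷ x ∷ u ⟶ y ∷ x ∷ z ∷ u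
  knuth₂ : ∀ {x y z u} → x ≤ y → y < z → x ∷ z ∷ y ∷ u ⟶ z ∷ x ∷ y ∷ u
  _∷_    : ∀ {u v} a → u ⟶ v → a ∷ u ⟶ a ∷ v

_∼_ : Word → Word → Set
_∼_ = Eq.EqClosure _⟶_

∼-refl : ∀ {u} → u ∼ u
∼-refl = Eq.reflexive _⟶_

∼-trans : ∀ {u v w} → u ∼ v → v ∼ w → u ∼ w
∼-trans = Eq.transitive _⟶_

≡⇒∼ : ∀ {u v} → u ≡ v → u ∼ v
≡⇒∼ refl = ∼-refl

⟶-++ : ∀ {u v} w → u ⟶ v → u ++ w ⟶ v ++ w
⟶-++ w (knuth₁ p q) = knuth₁ p q
⟶-++ w (knuth₂ p q) = knuth₂ p q
⟶-++ w (a ∷ s)      = a ∷ ⟶-++ w s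

++-⟶ : ∀ {u v} w → u ⟶ v → w ++ u ⟶ w ++ v
++-⟶ []      s = s
++-⟶ (a ∷ w) s = a ∷ ++-⟶ w s

∼-++ : ∀ {u v} w → u ∼ v → u ++ w ∼ v ++ w
∼-++ w = Eq.gmap (_++ w) (⟶-++ w)

++-∼ : ∀ {u v} w → u ∼ v → w ++ u ∼ w ++ v
++-∼ w = Eq.gmap (w ++_) (++-⟶ w)

insertWord-⟶ : ∀ {u v} t → WeakTableau t → u ⟶ v →
  foldl (λ t x → insertRS x t) t u ≡ foldl (λ t x → insertRS x t) t v
insertWord-⟶ t w (knuth₁ {u = u} p q) = cong (λ s → foldl _ s u) (insertRS-knuth₁ t p q w)
insertWord-⟶ t w (knuth₂ {u = u} p q) = cong (λ s → foldl _ s u) (insertRS-knuth₂ t p q w)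
insertWord-⟶ t w (a ∷ s) = insertWord-⟶ (insertRS a t) (insertRS-weak a t w) s

P-∼ : ∀ {u v} → u ∼ v → P u ≡ P v
P-∼ = Eq.gfold isEquivalence P (insertWord-⟶ [] [])

-- Restriction of Knuth equivalence to an interval of letters

module _ {p} {Q : Pred ℕ p} (Q? : Decidable Q)
         (convex : ∀ {x y z} → x ≤ y → y ≤ z → Q x → Q z → Q y) where

  private
    keep : ∀ {x} → Dec (Q x) → Word → Word
    keep {x} (yes _) u = x ∷ u
    keep     (no _)  u = u

    filter-∷ : ∀ x u → filter Q? (x ∷ u) ≡ keep (Q? x) (filter Q? u)
    filter-∷ x u with Q? x
    ... | yes _ = refl
    ... | no  _ = refl

    -- If the smallest or the largest letter is dropped, the two sides coincide. If both are kept,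
    -- convexity keeps the middle one, and the same Knuth relation applies.
    keep-knuth₁ : ∀ {x y z u} → x < y → y ≤ z → (x? : Dec (Q x)) (y? : Dec (Q y)) (z? : Dec (Q z)) →
                  keep y? (keep z? (keep x? u)) ∼ keep y? (keep x? (keep z? u))
    keep-knuth₁ x<y y≤z (no _)   _       (yes _)  = ∼-refl
    keep-knuth₁ x<y y≤z (no _)   _       (no _)   = ∼-refl
    keep-knuth₁ x<y y≤z (yes _)  _       (no _)   = ∼-refl
    keep-knuth₁ x<y y≤z (yes _)  (yes _) (yes _)  = Eq.return (knuth₁ x<y y≤z)
    keep-knuth₁ x<y y≤z (yes qx) (no ¬qy) (yes qz) = contradiction (convex (<⇒≤ x<y) y≤z qx qz) ¬qy

    keep-knuth₂ : ∀ {x y z u} → x ≤ y → y < z → (x? : Dec (Q x)) (y? : Dec (Q y)) (z? : Dec (Q z)) →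
                  keep x? (keep z? (keep y? u)) ∼ keep z? (keep x? (keep y? u))
    keep-knuth₂ x≤y y<z (no _)   _       (yes _)  = ∼-refl
    keep-knuth₂ x≤y y<z (no _)   _       (no _)   = ∼-refl
    keep-knuth₂ x≤y y<z (yes _)  _       (no _)   = ∼-refl
    keep-knuth₂ x≤y y<z (yes _)  (yes _) (yes _)  = Eq.return (knuth₂ x≤y y<z)
    keep-knuth₂ x≤y y<z (yes qx) (no ¬qy) (yes qz) = contradiction (convex x≤y (<⇒≤ y<z) qx qz) ¬qy

    filter-⟶ : ∀ {u v} → u ⟶ v → filter Q? u ∼ filter Q? v
    filter-⟶ (knuth₁ {x} {y} {z} {u} x<y y≤z)
      rewrite filter-∷ y (z ∷ x ∷ u) | filter-∷ z (x ∷ u) | filter-∷ x u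
            | filter-∷ y (x ∷ z ∷ u) | filter-∷ x (z ∷ u) | filter-∷ z u =
      keep-knuth₁ x<y y≤z (Q? x) (Q? y) (Q? z)
    filter-⟶ (knuth₂ {x} {y} {z} {u} x≤y y<z)
      rewrite filter-∷ x (z ∷ y ∷ u) | filter-∷ z (y ∷ u) | filter-∷ y u
            | filter-∷ z (x ∷ y ∷ u) | filter-∷ x (y ∷ u) | filter-∷ y u =
      keep-knuth₂ x≤y y<z (Q? x) (Q? y) (Q? z)
    filter-⟶ (a ∷ s) with Q? a
    ... | yes _ = Eq.gmap (a ∷_) (a ∷_) (filter-⟶ s)
    ... | no  _ = filter-⟶ s

  filter-∼ : ∀ {u v} → u ∼ v → filter Q? u ∼ filter Q? v
  filter-∼ = Eq.gfold (Eq.isEquivalence _⟶_) (filter Q?) filter-⟶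

-- Row insertion by Knuth relations, and reading words

-- The letter `x` moves left past the entries of `r` one at a time by `knuth₁`. The witness for each
-- exchange is the entry just before the one passed, which also exceeds `x`.
bump-∼ : ∀ {x a} r → x < a → WeakRow (a ∷ r) → a ∷ r ++ [ x ] ∼ a ∷ x ∷ r
bump-∼ []      x<a w = ∼-refl
bump-∼ (b ∷ r) x<a ((a≤b ∷ _) ∷ w) = ∼-trans
  (++-∼ [ _ ] (bump-∼ r (<-≤-trans x<a a≤b) w)) (Eq.return (knuth₁ x<a a≤b))

-- The inserted letter moves left until it stands just behind the letter to be bumped; that letter
-- then moves left to the front, past the entries that are at most `x`.
rowInsertion-∼ : ∀ {x r m r′} → RowInsertion x r m r′ → WeakRow r → r ++ [ x ] ∼ fromMaybe m ++ r′
rowInsertion-∼ append     w = ∼-refl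
rowInsertion-∼ (bump x<y) w = bump-∼ _ x<y w
rowInsertion-∼ {m = nothing} (skip _ i) (_ ∷ w) = ++-∼ [ _ ] (rowInsertion-∼ i w)
rowInsertion-∼ {x} {m = just y} (skip {a} a≤x i) (p ∷ w) = ∼-trans
  (++-∼ [ _ ] (rowInsertion-∼ i w)) (swapHead i p)
  where
  -- The witness for `knuth₂` is the head of `r′`: it is `x` itself or an entry passed by `x`, and
  -- in both cases lies between `a` and the bumped `y`.
  swapHead : ∀ {r r′} → RowInsertion x r (just y) r′ → All (a ≤_) r → a ∷ y ∷ r′ ∼ y ∷ a ∷ r′
  swapHead (bump x<y)   _         = Eq.return (knuth₂ a≤x x<y)
  swapHead (skip b≤x j) (a≤b ∷ _) = Eq.return (knuth₂ a≤b (≤-<-trans b≤x (bumped-> j)))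

-- Rows are read from bottom to top: a letter bumped to the front of its row then stands right
-- behind the reading word of the rows below, ready to be inserted there.
reading : Tableau → Word
reading []      = []
reading (r ∷ t) = reading t ++ r

reading-insertRS : ∀ x t → WeakTableau t → reading t ++ [ x ] ∼ reading (insertRS x t)
reading-insertRS? : ∀ m t → WeakTableau t → reading t ++ fromMaybe m ∼ reading (insertRS? m t)
reading-insertRS x []      w = ∼-refl
reading-insertRS x (r ∷ t) (w ∷ ws)
  rewrite insertRS-∷ t (rowInsertion x r) | ++-assoc (reading t) r [ x ] =
  ∼-trans (++-∼ (reading t) (rowInsertion-∼ (rowInsertion x r) w))
    (∼-trans (≡⇒∼ (sym (++-assoc (reading t) (fromMaybe m) _))) (∼-++ _ (reading-insertRS? m t ws)))
  where m = proj₁ (rowInsert x r)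
reading-insertRS? nothing  t ws rewrite ++-identityʳ (reading t) = ∼-refl
reading-insertRS? (just x) t ws = reading-insertRS x t ws

reading-insertWord : ∀ u t → WeakTableau t →
  reading t ++ u ∼ reading (foldl (λ t x → insertRS x t) t u)
reading-insertWord []      t w rewrite ++-identityʳ (reading t) = ∼-refl
reading-insertWord (a ∷ u) t w = ∼-trans
  (∼-trans (≡⇒∼ (sym (++-assoc (reading t) [ a ] u))) (∼-++ u (reading-insertRS a t w)))
  (reading-insertWord u (insertRS a t) (insertRS-weak a t w))

reading-P : ∀ u → u ∼ reading (P u)
reading-P u = reading-insertWord u [] []

-- Insertion tableaux of permutations are standard

rowInsertion-↭ : ∀ {x r m r′} → RowInsertion x r m r′ → fromMaybe m ++ r′ ↭ x ∷ r
rowInsertion-↭ append   = ↭-refl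
rowInsertion-↭ (bump _) = swap _ _ ↭-refl
rowInsertion-↭ {m = nothing} (skip _ i) = ↭-trans (prep _ (rowInsertion-↭ i)) (swap _ _ ↭-refl)
rowInsertion-↭ {m = just _}  (skip _ i) =
  ↭-trans (swap _ _ ↭-refl) (↭-trans (prep _ (rowInsertion-↭ i)) (swap _ _ ↭-refl))

insertRS-↭ : ∀ x t → concat (insertRS x t) ↭ x ∷ concat t
insertRS?-↭ : ∀ m t → concat (insertRS? m t) ↭ fromMaybe m ++ concat t
insertRS-↭ x []      = ↭-refl
insertRS-↭ x (r ∷ t) rewrite insertRS-∷ t (rowInsertion x r) =
  ↭-trans (Perm.++⁺ˡ r′ (insertRS?-↭ m t))
  (↭-trans (Perm.shifts r′ (fromMaybe m))
  (subst (_↭ x ∷ r ++ concat t) (++-assoc (fromMaybe m) r′ (concat t))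
    (Perm.++⁺ʳ (concat t) (rowInsertion-↭ (rowInsertion x r)))))
  where
  m  = proj₁ (rowInsert x r)
  r′ = proj₂ (rowInsert x r)
insertRS?-↭ nothing  t = ↭-refl
insertRS?-↭ (just x) t = insertRS-↭ x t

insertWord-↭ : ∀ u t → concat (foldl (λ t x → insertRS x t) t u) ↭ u ++ concat t
insertWord-↭ []      t = ↭-refl
insertWord-↭ (a ∷ u) t = ↭-trans (insertWord-↭ u (insertRS a t))
  (↭-trans (Perm.++⁺ˡ u (insertRS-↭ a t)) (Perm.shift a u (concat t)))

concat-P-↭ : ∀ u → concat (P u) ↭ u
concat-P-↭ u = subst (concat (P u) ↭_) (++-identityʳ u) (insertWord-↭ u [])

size≡length-concat : ∀ t → size t ≡ length (concat t)
size≡length-concat []      = refl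
size≡length-concat (r ∷ t) = trans (cong (length r +_) (size≡length-concat t)) (sym (length-++ r))

size-P : ∀ u → size (P u) ≡ length u
size-P u = trans (size≡length-concat (P u)) (Perm.↭-length (concat-P-↭ u))

rowInsertion-nonempty : ∀ {x r m r′} → RowInsertion x r m r′ → 1 ≤ length r′
rowInsertion-nonempty append     = s≤s z≤n
rowInsertion-nonempty (bump _)   = s≤s z≤n
rowInsertion-nonempty (skip _ _) = s≤s z≤n

insertRS-rowsNonempty : ∀ x t → All (λ r → 1 ≤ length r) t → All (λ r → 1 ≤ length r) (insertRS x t)
insertRS?-rowsNonempty : ∀ m t → All (λ r → 1 ≤ length r) t → All (λ r → 1 ≤ length r) (insertRS? m t)
insertRS-rowsNonempty x []      _ = s≤s z≤n ∷ []
insertRS-rowsNonempty x (r ∷ t) (_ ∷ ne) rewrite insertRS-∷ t (rowInsertion x r) =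
  rowInsertion-nonempty (rowInsertion x r) ∷ insertRS?-rowsNonempty (proj₁ (rowInsert x r)) t ne
insertRS?-rowsNonempty nothing  t ne = ne
insertRS?-rowsNonempty (just x) t ne = insertRS-rowsNonempty x t ne

-- Insertion either replaces an entry by a smaller one or lengthens the row, and both preserve the
-- inequalities with the row below.
rowInsertion-above : ∀ {x r m r′ s} → RowInsertion x r m r′ → ColsBelow r s → ColsBelow r′ s
rowInsertion-above i          nil          = nil
rowInsertion-above (bump x<y) (cons y<z c) = cons (<-trans x<y y<z) c
rowInsertion-above (skip _ i) (cons y<z c) = cons y<z (rowInsertion-above i c)

-- The entry of `s` below the old cell of `y`, if there is one, exceeds `y`. So `y` lands in that
-- column or further left, under an entry of `r′` that is at most `x`, hence smaller than `y`.
bumped-below : ∀ {x r y r′ s m s′} → RowInsertion x r (just y) r′ → RowInsertion y s m s′ →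
               ColsBelow r s → ColsBelow r′ s′
bumped-below (bump x<y)   append     nil          = cons x<y nil
bumped-below (bump x<y)   (bump _)   (cons _ c)   = cons x<y c
bumped-below (bump x<y)   (skip b≤y _) (cons y<b _) = contradiction y<b (≤⇒≯ b≤y)
bumped-below (skip a≤x i) append     nil          = cons (≤-<-trans a≤x (bumped-> i)) nil
bumped-below (skip a≤x i) (bump _)   (cons _ c)   =
  cons (≤-<-trans a≤x (bumped-> i)) (rowInsertion-above i c)
bumped-below (skip _ i)   (skip _ j) (cons a<b c) = cons a<b (bumped-below i j c)

insertRS-colsIncr : ∀ x t → ColsIncr t → ColsIncr (insertRS x t)
insertRS?-colsIncr : ∀ {x r m r′} t → RowInsertion x r m r′ → ColsIncr (r ∷ t) →
                     ColsIncr (r′ ∷ insertRS? m t)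
insertRS-colsIncr x []      c = single _
insertRS-colsIncr x (r ∷ t) c rewrite insertRS-∷ t (rowInsertion x r) =
  insertRS?-colsIncr t (rowInsertion x r) c
insertRS?-colsIncr {m = nothing} []      i c = single _
insertRS?-colsIncr {m = just y}  []      i c = cons (bumped-below i append nil) (single _)
insertRS?-colsIncr {m = nothing} (s ∷ t) i (cons b c) = cons (rowInsertion-above i b) c
insertRS?-colsIncr {m = just y}  (s ∷ t) i (cons b c) rewrite insertRS-∷ t (rowInsertion y s) =
  cons (bumped-below i (rowInsertion y s) b) (insertRS?-colsIncr t (rowInsertion y s) c)

module _ {q} {Q : Tableau → Set q} (insertRS-Q : ∀ x t → Q t → Q (insertRS x t)) where

  insertWord-preserves : ∀ u t → Q t → Q (foldl (λ t x → insertRS x t) t u)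
  insertWord-preserves []      t qt = qt
  insertWord-preserves (a ∷ u) t qt = insertWord-preserves u (insertRS a t) (insertRS-Q a t qt)

rowIncr : ∀ {r} → WeakRow r → Unique r → RowIncr r
rowIncr {[]}        _ _ = nil
rowIncr {_ ∷ []}    _ _ = single _
rowIncr {_ ∷ _ ∷ _} ((x≤y ∷ _) ∷ w) ((x≢y ∷ _) ∷ u) = cons (≤∧≢⇒< x≤y x≢y) (rowIncr w u)

unique-++⁻ : ∀ {a} {A : Set a} (xs : List A) {ys} → Unique (xs ++ ys) → Unique xs × Unique ys
unique-++⁻ []       u = [] , u
unique-++⁻ (x ∷ xs) (p ∷ u) with u₁ , u₂ ← unique-++⁻ xs u = All.++⁻ˡ xs p ∷ u₁ , u₂

rowsIncr : ∀ t → WeakTableau t → Unique (concat t) → All RowIncr t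
rowsIncr []      _        _ = []
rowsIncr (r ∷ t) (w ∷ ws) u with u₁ , u₂ ← unique-++⁻ r u = rowIncr w u₁ ∷ rowsIncr t ws u₂

unique-resp-↭ : ∀ {a} {A : Set a} {xs ys : List A} → xs ↭ ys → Unique xs → Unique ys
unique-resp-↭ {A = A} p = SetoidPerm.Unique-resp-↭ (↭⇒↭ₛ p)
  where import Data.List.Relation.Binary.Permutation.Setoid.Properties (setoid A) as SetoidPerm

oneTo-unique : ∀ n → Unique (oneTo n)
oneTo-unique n = Unique.map⁺ suc-injective (Unique.upTo⁺ n)

P-standard : ∀ {n σ} → 1 ≤ n → σ ↭ oneTo n → IsStandard (P σ)
P-standard {n} {σ} 1≤n σ↭ = record
  { rowsNonempty = insertWord-preserves insertRS-rowsNonempty σ [] []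
  ; rowsIncr     = rowsIncr (P σ) (insertWord-preserves insertRS-weak σ [] [])
                     (unique-resp-↭ (↭-sym concat↭) (oneTo-unique n))
  ; colsIncr     = insertWord-preserves insertRS-colsIncr σ [] nil
  ; entries      = subst (λ k → concat (P σ) ↭ oneTo k) (sym size≡n) concat↭
  ; sizePos      = subst (1 ≤_) (sym size≡n) 1≤n
  }
  where
  concat↭ : concat (P σ) ↭ oneTo n
  concat↭ = ↭-trans (concat-P-↭ σ) σ↭
  size≡n : size (P σ) ≡ n
  size≡n = trans (size-P σ) (trans (Perm.↭-length σ↭)
             (trans (length-map suc (upTo n)) (length-upTo n)))

-- Permutations in one-line notation

-- The starting point moves along the recursion exactly as in `occurrences`, which `oneTo` does not
-- offer.
interval : ℕ → ℕ → List ℕ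
interval i zero    = []
interval i (suc n) = i ∷ interval (suc i) n

oneTo≡interval : ∀ n → oneTo n ≡ interval 1 n
oneTo≡interval n = trans (map-upTo suc n) (applyUpTo≡interval suc 1 n (λ i → sym (+-comm i 1)))
  where
  applyUpTo≡interval : ∀ f i n → (∀ j → f j ≡ j + i) → applyUpTo f n ≡ interval i n
  applyUpTo≡interval f i zero    f≡ = refl
  applyUpTo≡interval f i (suc n) f≡ =
    cong₂ _∷_ (f≡ 0) (applyUpTo≡interval (f ∘ suc) (suc i) n (λ j → trans (f≡ (suc j)) (sym (+-suc j i))))

length-oneTo : ∀ n → length (oneTo n) ≡ n
length-oneTo n = trans (length-map suc (upTo n)) (length-upTo n)

oneTo-suc-↭ : ∀ n → oneTo (suc n) ↭ suc n ∷ oneTo n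
oneTo-suc-↭ n = subst (_↭ suc n ∷ oneTo n)
  (trans (sym (map-++ suc (upTo n) [ n ])) (cong (map suc) (upTo-∷ʳ n)))
  (↭-trans (Perm.shift (suc n) (oneTo n) []) (↭-reflexive (cong (suc n ∷_) (++-identityʳ (oneTo n)))))

interval-≥ : ∀ i n → All (i ≤_) (interval i n)
interval-≥ i zero    = []
interval-≥ i (suc n) = ≤-refl ∷ All.map (≤-trans (n≤1+n i)) (interval-≥ (suc i) n)

interval-unique : ∀ i n → Unique (interval i n)
interval-unique i zero    = []
interval-unique i (suc n) = All.map <⇒≢ (interval-≥ (suc i) n) ∷ interval-unique (suc i) n

insertions-↭ : ∀ x τ {σ} → σ ∈ insertions x τ → σ ↭ x ∷ τ
insertions-↭ x []      (here refl) = ↭-refl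
insertions-↭ x (y ∷ τ) (here refl) = ↭-refl
insertions-↭ x (y ∷ τ) (there σ∈) with _ , ρ∈ , refl ← ∈-map⁻ (y ∷_) σ∈ =
  ↭-trans (prep y (insertions-↭ x τ ρ∈)) (swap y x ↭-refl)

∈-insertions : ∀ x σ τ → σ ++ x ∷ τ ∈ insertions x (σ ++ τ)
∈-insertions x []      []      = here refl
∈-insertions x []      (y ∷ τ) = here refl
∈-insertions x (y ∷ σ) τ       = there (∈-map⁺ (y ∷_) (∈-insertions x σ τ))

perms-↭ : ∀ n {σ} → σ ∈ perms n → σ ↭ oneTo n
perms-↭ zero    (here refl) = ↭-refl
perms-↭ (suc n) σ∈ with τ , τ∈ , σ∈′ ← find (∈-concatMap⁻ (insertions (suc n)) {xs = perms n} σ∈) =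
  ↭-trans (insertions-↭ (suc n) τ σ∈′) (↭-trans (prep _ (perms-↭ n τ∈)) (↭-sym (oneTo-suc-↭ n)))

∈-perms : ∀ n {σ} → σ ↭ oneTo n → σ ∈ perms n
∈-perms zero    σ↭ rewrite Perm.↭-empty-inv σ↭ = here refl
∈-perms (suc n) σ↭
  with σ↭′ ← ↭-trans σ↭ (oneTo-suc-↭ n)
  with α , β , refl ← ∈-∃++ (Perm.∈-resp-↭ (↭-sym σ↭′) (here refl)) =
  ∈-concatMap⁺ (insertions (suc n))
    (Any.map (λ { refl → ∈-insertions (suc n) α β }) (∈-perms n (Perm.drop-mid α [] σ↭′)))

-- Deleting x recovers τ, so insertions into different words are disjoint.
module _ (x : ℕ) where

  ≢x? : Decidable (_≢ x)
  ≢x? y = ¬? (y ≟ x)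

  insertions-delete : ∀ τ {σ} → All (_≢ x) τ → σ ∈ insertions x τ → filter ≢x? σ ≡ τ
  insertions-delete []      _  (here refl) = filter-reject ≢x? (λ x≢x → x≢x refl)
  insertions-delete (y ∷ τ) ps (here refl) =
    trans (filter-reject ≢x? (λ x≢x → x≢x refl)) (filter-all ≢x? ps)
  insertions-delete (y ∷ τ) (p ∷ ps) (there σ∈) with _ , ρ∈ , refl ← ∈-map⁻ (y ∷_) σ∈ =
    trans (filter-accept ≢x? p) (cong (y ∷_) (insertions-delete τ ps ρ∈))

insertions-unique : ∀ x τ → All (_≢ x) τ → Unique (insertions x τ)
insertions-unique x []      _        = [] ∷ []
insertions-unique x (y ∷ τ) (y≢x ∷ ps) =
  All.tabulate (λ { σ∈ refl → x≢head (∈-map⁻ (y ∷_) σ∈) })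
  ∷ Unique.map⁺ (proj₂ ∘ ∷-injective) (insertions-unique x τ ps)
  where
  x≢head : ¬ ∃ λ ρ → ρ ∈ insertions x τ × x ∷ y ∷ τ ≡ y ∷ ρ
  x≢head (_ , _ , eq) = y≢x (sym (proj₁ (∷-injective eq)))

-- The sum that defines `S` runs over this list; each permutation must be listed once for that sum
-- to collapse to a single term with coefficient 1.
perms-unique : ∀ n → Unique (perms n)
perms-unique zero    = [] ∷ []
perms-unique (suc n) = Unique.concat⁺
  (All.map⁺ (All.tabulate (λ {τ} τ∈ → insertions-unique (suc n) τ (fresh τ∈))))
  (AllPairs.map⁺ (disjoint (perms n) id (perms-unique n)))
  where
  fresh : ∀ {τ} → τ ∈ perms n → All (_≢ suc n) τ
  fresh τ∈ = All.tabulate λ { y∈ refl →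
    Unique.Unique[x∷xs]⇒x∉xs (unique-resp-↭ (oneTo-suc-↭ n) (oneTo-unique (suc n)))
      (Perm.∈-resp-↭ (perms-↭ n τ∈) y∈) }
  disjoint : ∀ τs → (∀ {τ} → τ ∈ τs → τ ∈ perms n) → Unique τs →
             AllPairs (λ τ τ′ → Disjoint (insertions (suc n) τ) (insertions (suc n) τ′)) τs
  disjoint []       inc _        = []
  disjoint (τ ∷ τs) inc (p ∷ ps) =
    All.tabulate (λ {τ′} τ′∈ (σ∈ , σ∈′) → All.lookup p τ′∈
      (trans (sym (insertions-delete (suc n) τ (fresh (inc (here refl))) σ∈))
             (insertions-delete (suc n) τ′ (fresh (inc (there τ′∈))) σ∈′)))
    ∷ disjoint τs (inc ∘ there) ps

-- Inverse of a permutation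

position-here : ∀ k u → position k (k ∷ u) ≡ 1
position-here k u with k ≟ k
... | yes _   = refl
... | no  k≢k = contradiction refl k≢k

position-there : ∀ {k x} u → k ≢ x → position k (x ∷ u) ≡ suc (position k u)
position-there {k} {x} u k≢x with k ≟ x
... | yes k≡x = contradiction k≡x k≢x
... | no  _   = refl

position-positive : ∀ {k u} → k ∈ u → position k u ≢ 0
position-positive {k} {x ∷ u} _ with k ≟ x
... | yes _ = λ ()
... | no  _ = λ ()

-- Position 1 determines the head. Once equal heads are removed, all remaining positions drop by one
-- on both sides.
position-injective : ∀ {σ τ} → Unique σ → σ ↭ τ → (∀ {k} → k ∈ σ → position k σ ≡ position k τ) → σ ≡ τ
position-injective {[]}    u σ↭τ eq = sym (Perm.↭-empty-inv (↭-sym σ↭τ))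
position-injective {x ∷ σ} {[]} u σ↭τ eq with () ← Perm.∈-resp-↭ σ↭τ (here refl)
position-injective {x ∷ σ} {y ∷ τ} (p ∷ u) σ↭τ eq with x ≟ y
... | no x≢y = contradiction
  (suc-injective (trans (sym (position-there τ x≢y)) (trans (sym (eq (here refl))) (position-here x σ))))
  (position-positive (Any.tail x≢y (Perm.∈-resp-↭ σ↭τ (here refl))))
... | yes refl = cong (x ∷_) (position-injective u (Perm.drop-∷ σ↭τ) λ k∈ →
  let k≢x = λ k≡x → All.lookup p k∈ (sym k≡x) in
  suc-injective (trans (sym (position-there σ k≢x)) (trans (eq (there k∈)) (position-there τ k≢x))))

map-≡⁻ : ∀ {a b} {A : Set a} {B : Set b} {f g : A → B} xs →
         map f xs ≡ map g xs → ∀ {x} → x ∈ xs → f x ≡ g x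
map-≡⁻ (x ∷ xs) eq (here refl) = proj₁ (∷-injective eq)
map-≡⁻ (x ∷ xs) eq (there x∈)  = map-≡⁻ xs (proj₂ (∷-injective eq)) x∈

inverse-injective : ∀ {n σ τ} → σ ↭ oneTo n → τ ↭ oneTo n → inverse σ ≡ inverse τ → σ ≡ τ
inverse-injective {n} {σ} {τ} σ↭ τ↭ eq = position-injective
  (unique-resp-↭ (↭-sym σ↭) (oneTo-unique n)) (↭-trans σ↭ (↭-sym τ↭))
  λ k∈ → map-≡⁻ (oneTo n) eq′ (Perm.∈-resp-↭ σ↭ k∈)
  where
  length≡n : ∀ {ρ} → ρ ↭ oneTo n → length ρ ≡ n
  length≡n ρ↭ = trans (Perm.↭-length ρ↭) (length-oneTo n)
  eq′ : map (λ k → position k σ) (oneTo n) ≡ map (λ k → position k τ) (oneTo n)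
  eq′ = subst₂ (λ l m → map (λ k → position k σ) (oneTo l) ≡ map (λ k → position k τ) (oneTo m))
          (length≡n σ↭) (length≡n τ↭) eq

length-inverse : ∀ σ → length (inverse σ) ≡ length σ
length-inverse σ = trans (length-map _ (oneTo (length σ))) (length-oneTo (length σ))

length-std : ∀ w → length (std w) ≡ length w
length-std w = go [] w
  where
  go : ∀ u v → length (stdAux w u v) ≡ length v
  go u []      = refl
  go u (x ∷ v) = cong suc (go (u ++ [ x ]) v)

-- Inverse of the standardization

-- The second component of a pair is the position of an occurrence of the first one.
Occurrences : Set
Occurrences = List (ℕ × ℕ)

-- Ties put the new occurrence first. Since `occurrences` builds the list from the right end of the
-- word, the new occurrence is the leftmost so far, and the sort is stable.
insertOcc : ℕ × ℕ → Occurrences → Occurrences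
insertOcc p []      = [ p ]
insertOcc p (q ∷ l) with proj₁ p ≤? proj₁ q
... | yes _ = p ∷ q ∷ l
... | no  _ = q ∷ insertOcc p l

occurrences : ℕ → Word → Occurrences
occurrences i []      = []
occurrences i (x ∷ w) = insertOcc (x , i) (occurrences (suc i) w)

-- For i = 1 this is the inverse of std w.
sortedPositions : ℕ → Word → Word
sortedPositions i w = map proj₂ (occurrences i w)

Sorted : Occurrences → Set
Sorted = AllPairs (λ p q → proj₁ p ≤ proj₁ q)

insertOcc-↭ : ∀ p l → insertOcc p l ↭ p ∷ l
insertOcc-↭ p []      = ↭-refl
insertOcc-↭ p (q ∷ l) with proj₁ p ≤? proj₁ q
... | yes _ = ↭-refl
... | no  _ = ↭-trans (prep q (insertOcc-↭ p l)) (swap q p ↭-refl)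

insertOcc-sorted : ∀ p l → Sorted l → Sorted (insertOcc p l)
insertOcc-sorted p []      _        = [] ∷ []
insertOcc-sorted p (q ∷ l) (r ∷ rs) with proj₁ p ≤? proj₁ q
... | yes p≤q = (p≤q ∷ All.map (≤-trans p≤q) r) ∷ r ∷ rs
... | no  p≰q =
  Perm.All-resp-↭ (↭-sym (insertOcc-↭ p l)) (<⇒≤ (≰⇒> p≰q) ∷ r) ∷ insertOcc-sorted p l rs

occurrences-sorted : ∀ i w → Sorted (occurrences i w)
occurrences-sorted i []      = []
occurrences-sorted i (x ∷ w) = insertOcc-sorted (x , i) _ (occurrences-sorted (suc i) w)

occurrences-letters : ∀ i w → map proj₁ (occurrences i w) ↭ w
occurrences-letters i []      = ↭-refl
occurrences-letters i (x ∷ w) =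
  ↭-trans (Perm.map⁺ proj₁ (insertOcc-↭ (x , i) _)) (prep x (occurrences-letters (suc i) w))

sortedPositions-↭ : ∀ i w → sortedPositions i w ↭ interval i (length w)
sortedPositions-↭ i []      = ↭-refl
sortedPositions-↭ i (x ∷ w) =
  ↭-trans (Perm.map⁺ proj₂ (insertOcc-↭ (x , i) _)) (prep i (sortedPositions-↭ (suc i) w))

sortedPositions-unique : ∀ i w → Unique (sortedPositions i w)
sortedPositions-unique i w =
  unique-resp-↭ (↭-sym (sortedPositions-↭ i w)) (interval-unique i (length w))

occurrences-≥ : ∀ i w → All (λ p → i ≤ proj₂ p) (occurrences i w)
occurrences-≥ i w = All.map⁻ (Perm.All-resp-↭ (↭-sym (sortedPositions-↭ i w)) (interval-≥ i (length w)))

sortedPositions-shift : ∀ j i w → map (j +_) (sortedPositions i w) ≡ sortedPositions (j + i) w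
sortedPositions-shift j i w = trans (sym (map-∘ (occurrences i w)))
  (trans (map-∘ (occurrences i w)) (cong (map proj₂) (shiftOcc i w)))
  where
  shift : ℕ × ℕ → ℕ × ℕ
  shift (x , k) = x , j + k
  shift-insertOcc : ∀ p l → map shift (insertOcc p l) ≡ insertOcc (shift p) (map shift l)
  shift-insertOcc p []      = refl
  shift-insertOcc p (q ∷ l) with proj₁ p ≤? proj₁ q
  ... | yes _ = refl
  ... | no  _ = cong (shift q ∷_) (shift-insertOcc p l)
  shiftOcc : ∀ i w → map shift (occurrences i w) ≡ occurrences (j + i) w
  shiftOcc i []      = refl
  shiftOcc i (x ∷ w) = trans (shift-insertOcc (x , i) (occurrences (suc i) w))
    (cong (insertOcc (x , j + i)) (trans (shiftOcc (suc i) w) (cong (λ k → occurrences k w) (+-suc j i))))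

insertOcc-least : ∀ p l → All (λ r → proj₁ p ≤ proj₁ r) l → insertOcc p l ≡ p ∷ l
insertOcc-least p []      _ = refl
insertOcc-least p (r ∷ l) (p≤r ∷ _) with proj₁ p ≤? proj₁ r
... | yes _   = refl
... | no  p≰r = contradiction p≤r p≰r

-- Restriction of the sorted positions to a factor

module _ {q} {Q : Pred (ℕ × ℕ) q} (Q? : Decidable Q) where

  filter-insertOcc-reject : ∀ p l → ¬ Q p → filter Q? (insertOcc p l) ≡ filter Q? l
  filter-insertOcc-reject p []      ¬qp = filter-reject Q? ¬qp
  filter-insertOcc-reject p (r ∷ l) ¬qp with proj₁ p ≤? proj₁ r
  ... | yes _ = filter-reject Q? ¬qp
  ... | no  _ with Q? r
  ...   | yes _ = cong (r ∷_) (filter-insertOcc-reject p l ¬qp)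
  ...   | no  _ = filter-insertOcc-reject p l ¬qp

  filter-insertOcc-accept : ∀ p l → Q p → Sorted l → filter Q? (insertOcc p l) ≡ insertOcc p (filter Q? l)
  filter-insertOcc-accept p []      qp _ = filter-accept Q? qp
  filter-insertOcc-accept p (r ∷ l) qp (r≤ ∷ s) with proj₁ p ≤? proj₁ r in eq
  -- The entry `r` may itself be filtered out, but by sortedness `p` is at most every entry that
  -- remains and so still goes to the front.
  ... | yes p≤r = trans (filter-accept Q? qp)
    (sym (insertOcc-least p _ (All.filter⁺ Q? (p≤r ∷ All.map (≤-trans p≤r) r≤))))
  ... | no  p≰r with Q? r
  ...   | yes _ rewrite eq = cong (r ∷_) (filter-insertOcc-accept p l qp s)
  ...   | no  _ = filter-insertOcc-accept p l qp s

occurrences-suffix : ∀ {m} i u v → i + length u ≡ m →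
  filter (λ p → m ≤? proj₂ p) (occurrences i (u ++ v)) ≡ occurrences m v
occurrences-suffix i []      v refl rewrite +-identityʳ i =
  filter-all _ (occurrences-≥ i v)
occurrences-suffix i (x ∷ u) v refl = trans
  (filter-insertOcc-reject (λ p → _ ≤? proj₂ p) (x , i) (occurrences (suc i) (u ++ v))
    (<⇒≱ (m<m+n i (s≤s z≤n))))
  (occurrences-suffix (suc i) u v (sym (+-suc i (length u))))

occurrences-prefix : ∀ {m} i u v → i + length u ≡ m →
  filter (λ p → proj₂ p <? m) (occurrences i (u ++ v)) ≡ occurrences i u
occurrences-prefix i []      v refl rewrite +-identityʳ i =
  filter-none _ (All.map ≤⇒≯ (occurrences-≥ i v))
occurrences-prefix i (x ∷ u) v refl = trans
  (filter-insertOcc-accept (λ p → proj₂ p <? _) (x , i) (occurrences (suc i) (u ++ v))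
    (m<m+n i (s≤s z≤n)) (occurrences-sorted (suc i) (u ++ v)))
  (cong (insertOcc (x , i)) (occurrences-prefix (suc i) u v (sym (+-suc i (length u)))))

filter-map : ∀ {a b p} {A : Set a} {B : Set b} {Q : Pred B p} (Q? : Decidable Q) (f : A → B) xs →
             filter Q? (map f xs) ≡ map f (filter (Q? ∘ f) xs)
filter-map Q? f []       = refl
filter-map Q? f (x ∷ xs) with Q? (f x)
... | yes _ = cong (f x ∷_) (filter-map Q? f xs)
... | no  _ = filter-map Q? f xs

sortedPositions-suffix : ∀ {m} i u v → i + length u ≡ m →
  filter (m ≤?_) (sortedPositions i (u ++ v)) ≡ sortedPositions m v
sortedPositions-suffix i u v eq =
  trans (filter-map _ proj₂ (occurrences i (u ++ v))) (cong (map proj₂) (occurrences-suffix i u v eq))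

sortedPositions-prefix : ∀ {m} i u v → i + length u ≡ m →
  filter (_<? m) (sortedPositions i (u ++ v)) ≡ sortedPositions i u
sortedPositions-prefix i u v eq =
  trans (filter-map _ proj₂ (occurrences i (u ++ v))) (cong (map proj₂) (occurrences-prefix i u v eq))

-- Standardization as the inverse of the sorted positions

countLess-↭ : ∀ x {u v} → u ↭ v → countLess x u ≡ countLess x v
countLess-↭ x u↭v = Perm.↭-length (Perm.filter-↭ (_<? x) u↭v)

position-insertOcc-new : ∀ x s l → Sorted l → All (λ p → s ≢ proj₂ p) l →
  position s (map proj₂ (insertOcc (x , s) l)) ≡ suc (countLess x (map proj₁ l))
position-insertOcc-new x s []            _ _ = position-here s []
position-insertOcc-new x s ((y , j) ∷ l) (p ∷ ps) (s≢j ∷ new) with x ≤? y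
... | yes x≤y = trans (position-here s _) (cong (suc ∘ length)
  (sym (filter-none (_<? x) {xs = y ∷ map proj₁ l} (≤⇒≯ x≤y ∷ All.map⁺ (All.map (≤⇒≯ ∘ ≤-trans x≤y) p)))))
... | no  x≰y = trans (position-there _ s≢j) (cong suc
  (trans (position-insertOcc-new x s l ps new) (cong length (sym (filter-accept (_<? x) (≰⇒> x≰y))))))

-- The new occurrence goes in front of its equals as well, so every letter that is at least `y` is
-- pushed back by one; `position-insertOcc->` treats the letters that stay.
position-insertOcc-≤ : ∀ {y x q p} l → y ≤ x → Unique (map proj₂ l) → (x , p) ∈ l → p ≢ q →
  position p (map proj₂ (insertOcc (y , q) l)) ≡ suc (position p (map proj₂ l))
position-insertOcc-≤ {y} {x} {q} {p} ((z , r) ∷ l) y≤x (r∉ ∷ u) xp∈ p≢q with y ≤? z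
... | yes _   = position-there _ p≢q
... | no  y≰z with xp∈
...   | here refl = contradiction y≤x y≰z
...   | there xp∈l = trans (position-there _ p≢r)
          (cong suc (trans (position-insertOcc-≤ l y≤x u xp∈l p≢q) (sym (position-there _ p≢r))))
  where
  p≢r : p ≢ r
  p≢r p≡r = All.lookup r∉ (∈-map⁺ proj₂ xp∈l) (sym p≡r)

position-insertOcc-> : ∀ {y x q p} l → x < y → Sorted l → (x , p) ∈ l →
  position p (map proj₂ (insertOcc (y , q) l)) ≡ position p (map proj₂ l)
position-insertOcc-> {y} {x} {q} {p} ((z , r) ∷ l) x<y (z≤ ∷ s) xp∈ with y ≤? z | xp∈
... | yes y≤z | here refl  = contradiction x<y (≤⇒≯ y≤z)
... | yes y≤z | there xp∈l = contradiction (<-≤-trans x<y y≤z) (≤⇒≯ (All.lookup z≤ xp∈l))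
... | no  y≰z | here refl  = trans (position-here p _) (sym (position-here p _))
... | no  y≰z | there xp∈l with p ≟ r
...   | yes _ = refl
...   | no  _ = cong suc (position-insertOcc-> l x<y s xp∈l)

∈-occurrences : ∀ i u x v → (x , i + length u) ∈ occurrences i (u ++ x ∷ v)
∈-occurrences i []      x v rewrite +-identityʳ i =
  Perm.∈-resp-↭ (↭-sym (insertOcc-↭ (x , i) (occurrences (suc i) v))) (here refl)
∈-occurrences i (y ∷ u) x v rewrite +-suc i (length u) =
  Perm.∈-resp-↭ (↭-sym (insertOcc-↭ (y , i) (occurrences (suc i) (u ++ x ∷ v))))
    (there (∈-occurrences (suc i) u x v))

-- The right-hand side is the label that `stdAux` gives to this occurrence of `x`. A letter `y` of
-- the prefix pushes the occurrence back by one if `y < x`, recorded in `countLess`, or if `y ≡ x`,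
-- recorded in `countEq`, and otherwise not at all.
position-sortedPositions : ∀ i u x v →
  position (i + length u) (sortedPositions i (u ++ x ∷ v)) ≡ suc (countLess x (u ++ x ∷ v) + countEq x u)
position-sortedPositions i []      x v rewrite +-identityʳ i = trans
  (position-insertOcc-new x i (occurrences (suc i) v) (occurrences-sorted (suc i) v)
    (All.map <⇒≢ (occurrences-≥ (suc i) v)))
  (cong suc (trans (countLess-↭ x (occurrences-letters (suc i) v))
    (trans (cong length (sym (filter-reject (_<? x) (n≮n x)))) (sym (+-identityʳ _)))))
position-sortedPositions i (y ∷ u) x v rewrite +-suc i (length u) with <-cmp y x
... | tri< y<x y≢x _ = trans
  (position-insertOcc-≤ _ (<⇒≤ y<x) (sortedPositions-unique (suc i) (u ++ x ∷ v)) (∈-occurrences (suc i) u x v)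
    (>⇒≢ (s≤s (m≤m+n i (length u)))))
  (cong suc (trans (position-sortedPositions (suc i) u x v)
    (sym (cong₂ _+_ (cong length (filter-accept (_<? x) y<x)) (cong length (filter-reject (_≟ x) y≢x))))))
... | tri≈ y≮x refl _ = trans
  (position-insertOcc-≤ _ ≤-refl (sortedPositions-unique (suc i) (u ++ x ∷ v)) (∈-occurrences (suc i) u x v)
    (>⇒≢ (s≤s (m≤m+n i (length u)))))
  (cong suc (trans (position-sortedPositions (suc i) u x v) (trans (sym (+-suc _ _))
    (sym (cong₂ _+_ (cong length (filter-reject (_<? x) y≮x)) (cong length (filter-accept (_≟ x) refl)))))))
... | tri> y≮x y≢x x<y = trans
  (position-insertOcc-> _ x<y (occurrences-sorted (suc i) (u ++ x ∷ v)) (∈-occurrences (suc i) u x v))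
  (trans (position-sortedPositions (suc i) u x v) (cong suc
    (sym (cong₂ _+_ (cong length (filter-reject (_<? x) y≮x)) (cong length (filter-reject (_≟ x) y≢x))))))

sortedPositions-↭-oneTo : ∀ w → sortedPositions 1 w ↭ oneTo (length w)
sortedPositions-↭-oneTo w =
  subst (sortedPositions 1 w ↭_) (sym (oneTo≡interval (length w))) (sortedPositions-↭ 1 w)

std≡inverse : ∀ w → std w ≡ inverse (sortedPositions 1 w)
std≡inverse w = trans (go [] w refl) (cong (map _) (trans (sym (oneTo≡interval (length w))) (cong oneTo length≡)))
  where
  length≡ : length w ≡ length (sortedPositions 1 w)
  length≡ = sym (trans (Perm.↭-length (sortedPositions-↭-oneTo w)) (length-oneTo (length w)))
  go : ∀ u v → u ++ v ≡ w →
       stdAux w u v ≡ map (λ k → position k (sortedPositions 1 w)) (interval (suc (length u)) (length v))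
  go u []      _    = refl
  go u (x ∷ v) refl = cong₂ _∷_ (sym (position-sortedPositions 1 u x v))
    (trans (go (u ++ [ x ]) v (++-assoc u [ x ] v))
           (cong (λ n → map (λ k → position k (sortedPositions 1 w)) (interval (suc n) (length v)))
                 (trans (length-++ u) (+-comm (length u) 1))))

size-P-sortedPositions : ∀ w → size (P (sortedPositions 1 w)) ≡ length w
size-P-sortedPositions w = trans (size-P (sortedPositions 1 w))
  (trans (Perm.↭-length (sortedPositions-↭-oneTo w)) (length-oneTo (length w)))

length-std-inverse : ∀ n {σ} w → σ ∈ perms n → std w ≡ inverse σ → length w ≡ n
length-std-inverse n {σ} w σ∈ eq = trans (sym (length-std w)) (trans (cong length eq)
  (trans (length-inverse σ) (trans (Perm.↭-length (perms-↭ n σ∈)) (length-oneTo n))))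

std-inverse⇒ : ∀ n {σ} w → σ ∈ perms n → std w ≡ inverse σ → σ ≡ sortedPositions 1 w
std-inverse⇒ n w σ∈ eq = inverse-injective (perms-↭ n σ∈)
  (subst (λ k → sortedPositions 1 w ↭ oneTo k) (length-std-inverse n w σ∈ eq) (sortedPositions-↭-oneTo w))
  (trans (sym eq) (std≡inverse w))

-- Products in FSym

rowInsertion-shift : ∀ j {x r m r′} → RowInsertion x r m r′ →
  RowInsertion (j + x) (map (j +_) r) (Maybe.map (j +_) m) (map (j +_) r′)
rowInsertion-shift j append       = append
rowInsertion-shift j (bump x<y)   = bump (+-monoʳ-< j x<y)
rowInsertion-shift j (skip y≤x i) = skip (+-monoʳ-≤ j y≤x) (rowInsertion-shift j i)

shift : ℕ → Tableau → Tableau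
shift j = map (map (j +_))

insertRS-shift : ∀ j x t → insertRS (j + x) (shift j t) ≡ shift j (insertRS x t)
insertRS?-shift : ∀ j m t → insertRS? (Maybe.map (j +_) m) (shift j t) ≡ shift j (insertRS? m t)
insertRS-shift j x []      = refl
insertRS-shift j x (r ∷ t)
  rewrite insertRS-∷ t (rowInsertion x r) | insertRS-∷ (shift j t) (rowInsertion-shift j (rowInsertion x r)) =
  cong (_ ∷_) (insertRS?-shift j (proj₁ (rowInsert x r)) t)
insertRS?-shift j nothing  t = refl
insertRS?-shift j (just x) t = insertRS-shift j x t

-- Insertion only compares letters, and `j +_` preserves the order.
P-shift : ∀ j u → P (map (j +_) u) ≡ shift j (P u)
P-shift j u = go u []
  where
  go : ∀ u t → foldl (λ t x → insertRS x t) (shift j t) (map (j +_) u) ≡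
       shift j (foldl (λ t x → insertRS x t) t u)
  go []      t = refl
  go (x ∷ u) t rewrite insertRS-shift j x t = go u (insertRS x t)

shift-injective : ∀ j {t t′} → shift j t ≡ shift j t′ → t ≡ t′
shift-injective j = map-injective (map-injective (+-cancelˡ-≡ j _ _))

_≟ᵀ_ : DecidableEquality Tableau
_≟ᵀ_ = ≡-dec (≡-dec _≟_)

-- Permutations with a common insertion tableau would repeat it and multiply its coefficient, hence
-- the deduplication. Taking images of `P` makes standardness a consequence of `P-standard`.
tableaux : ℕ → List Tableau
tableaux n = deduplicate _≟ᵀ_ (map P (perms n))

tableaux-unique : ∀ n → Unique (tableaux n)
tableaux-unique n = DecUnique.deduplicate-! _≟ᵀ_ (map P (perms n))

∈-tableaux⁻ : ∀ n {t} → t ∈ tableaux n → ∃ λ σ → σ ↭ oneTo n × t ≡ P σ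
∈-tableaux⁻ n t∈ with σ , σ∈ , t≡ ← ∈-map⁻ P (∈-deduplicate⁻ _≟ᵀ_ (map P (perms n)) t∈) =
  σ , perms-↭ n σ∈ , t≡

P-∈-tableaux : ∀ {n σ} → σ ↭ oneTo n → P σ ∈ tableaux n
P-∈-tableaux {n} σ↭ = ∈-deduplicate⁺ _≟ᵀ_ (∈-map⁺ P (∈-perms n σ↭))

size-tableaux : ∀ n {t} → t ∈ tableaux n → size t ≡ n
size-tableaux n t∈ with σ , σ↭ , refl ← ∈-tableaux⁻ n t∈ =
  trans (size-P σ) (trans (Perm.↭-length σ↭) (length-oneTo n))

length-take-suc : ∀ {i} (w : Word) → i < length w → length (take (suc i) w) ≡ suc i
length-take-suc {i} w i<|w| = trans (length-take (suc i) w) (m≤n⇒m⊓n≡m i<|w|)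

module Product {c ℓ} (K : Field c ℓ) where

  open Series K
  open Field K using (Carrier; _≈_; _*_; 0#; 1#; *-cong; *-congˡ; *-congʳ; *-identityʳ; +-cong; +-congˡ)
    renaming (_+_ to _⊕_; refl to ≈-refl; trans to ≈-trans; reflexive to ≈-reflexive; setoid to ≈-setoid;
              zeroˡ to 0-*; zeroʳ to *-0; +-identityˡ to 0-⊕; +-identityʳ to ⊕-0)
  open import Relation.Binary.Reasoning.Setoid ≈-setoid

  module _ {a} {A : Set a} (f : A → Carrier) where

    Σ-list-zero : ∀ xs → (∀ {x} → x ∈ xs → f x ≈ 0#) → Σ-list (map f xs) ≈ 0#
    Σ-list-zero []       f≈0 = ≈-refl
    Σ-list-zero (x ∷ xs) f≈0 =
      ≈-trans (+-cong (f≈0 (here refl)) (Σ-list-zero xs (f≈0 ∘ there))) (0-⊕ 0#)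

    Σ-list-single : ∀ {x xs} → Unique xs → x ∈ xs → (∀ {y} → y ∈ xs → y ≢ x → f y ≈ 0#) →
                    Σ-list (map f xs) ≈ f x
    Σ-list-single {xs = x ∷ xs} (x∉ ∷ u) (here refl) f≈0 = ≈-trans
      (+-congˡ (Σ-list-zero xs λ y∈ → f≈0 (there y∈) (λ y≡x → All.lookup x∉ y∈ (sym y≡x)))) (⊕-0 _)
    Σ-list-single {xs = y ∷ xs} (y∉ ∷ u) (there x∈) f≈0 = ≈-trans
      (+-cong (f≈0 (here refl) (All.lookup y∉ x∈)) (Σ-list-single u x∈ (f≈0 ∘ there))) (0-⊕ _)

  *-zeroˡ : ∀ {x} y → x ≈ 0# → x * y ≈ 0#
  *-zeroˡ y x≈0 = ≈-trans (*-congʳ x≈0) (0-* y)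

  *-zeroʳ : ∀ x {y} → y ≈ 0# → x * y ≈ 0#
  *-zeroʳ x y≈0 = ≈-trans (*-congˡ y≈0) (*-0 x)

  indicatorP-≢ : ∀ t σ → P σ ≢ t → indicatorP t σ ≈ 0#
  indicatorP-≢ t σ P≢t with P σ ≟ᵀ t
  ... | yes P≡t = contradiction P≡t P≢t
  ... | no  _   = ≈-refl

  indicatorP-P : ∀ σ → indicatorP (P σ) σ ≈ 1#
  indicatorP-P σ with P σ ≟ᵀ P σ
  ... | yes _   = ≈-refl
  ... | no  P≢P = contradiction refl P≢P

  indicatorP-cong : ∀ t s σ τ → (P σ ≡ t → P τ ≡ s) → (P τ ≡ s → P σ ≡ t) → indicatorP t σ ≈ indicatorP s τ
  indicatorP-cong t s σ τ f g with P σ ≟ᵀ t | P τ ≟ᵀ s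
  ... | yes _   | yes _   = ≈-refl
  ... | no  _   | no  _   = ≈-refl
  ... | yes P≡t | no  P≢s = contradiction (f P≡t) P≢s
  ... | no  P≢t | yes P≡s = contradiction (g P≡s) P≢t

  F-≡ : ∀ σ w → std w ≡ inverse σ → F σ w ≈ 1#
  F-≡ σ w eq with ≡-dec _≟_ (std w) (inverse σ)
  ... | yes _   = ≈-refl
  ... | no  neq = contradiction eq neq

  F-≢ : ∀ σ w → std w ≢ inverse σ → F σ w ≈ 0#
  F-≢ σ w neq with ≡-dec _≟_ (std w) (inverse σ)
  ... | yes eq = contradiction eq neq
  ... | no  _  = ≈-refl

  indicatorP-length : ∀ t w → length w ≢ size t → indicatorP t (sortedPositions 1 w) ≈ 0#
  indicatorP-length t w |w|≢ = indicatorP-≢ t (sortedPositions 1 w)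
    λ P≡t → |w|≢ (trans (sym (size-P-sortedPositions w)) (cong size P≡t))

  -- Only the permutation inverse to `std w` contributes to the sum. If the length of `w` is not
  -- `size t`, that permutation is not in the list, and its insertion tableau has the wrong size.
  S≈indicatorP : ∀ t w → S t w ≈ indicatorP t (sortedPositions 1 w)
  S≈indicatorP t w with length w ≟ size t
  ... | yes |w|≡ = begin
    S t w
      ≈⟨ Σ-list-single (λ σ → indicatorP t σ * F σ w) (perms-unique (size t))
           (∈-perms (size t) (subst (λ n → sortedPositions 1 w ↭ oneTo n) |w|≡ (sortedPositions-↭-oneTo w)))
           (λ {σ} σ∈ σ≢ → *-zeroʳ _ (F-≢ σ w (σ≢ ∘ std-inverse⇒ (size t) w σ∈))) ⟩
    indicatorP t (sortedPositions 1 w) * F (sortedPositions 1 w) w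
      ≈⟨ *-congˡ (F-≡ (sortedPositions 1 w) w (std≡inverse w)) ⟩
    indicatorP t (sortedPositions 1 w) * 1#
      ≈⟨ *-identityʳ _ ⟩
    indicatorP t (sortedPositions 1 w) ∎
  ... | no |w|≢ = begin
    S t w
      ≈⟨ Σ-list-zero (λ σ → indicatorP t σ * F σ w) (perms (size t))
           (λ {σ} σ∈ → *-zeroʳ _ (F-≢ σ w (|w|≢ ∘ length-std-inverse (size t) w σ∈))) ⟩
    0#
      ≈⟨ indicatorP-length t w |w|≢ ⟨
    indicatorP t (sortedPositions 1 w) ∎

  S-length : ∀ t w → length w ≢ size t → S t w ≈ 0#
  S-length t w |w|≢ = ≈-trans (S≈indicatorP t w) (indicatorP-length t w |w|≢)

  indicatorP-∼ : ∀ t σ τ → σ ∼ τ → indicatorP t σ ≈ indicatorP t τ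
  indicatorP-∼ t σ τ σ∼τ = indicatorP-cong t t σ τ (trans (sym P≡)) (trans P≡)
    where
    P≡ : P σ ≡ P τ
    P≡ = P-∼ σ∼τ

  module _ (t′ t″ : Tableau) (j : ℕ) (|t′|≡ : size t′ ≡ suc j) (1≤|t″| : 1 ≤ size t″) where

    -- The letter shared by the two factors is counted once.
    n : ℕ
    n = j + size t″

    -- The two factors of w overlap in position j + 1; the positions in the second one are counted from j + 1 on,
    -- hence the shift.
    coefficient : Tableau → Carrier
    coefficient t = indicatorP t′ (filter (_<? suc (suc j)) (reading t))
                  * indicatorP (shift j t″) (filter (suc j ≤?_) (reading t))

    combination : List (Carrier × Tableau)
    combination = map (λ t → coefficient t , t) (tableaux n)

    combination-standard : All (λ p → IsStandard (proj₂ p)) combination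
    combination-standard = All.map⁺ (All.tabulate standard)
      where
      standard : ∀ {t} → t ∈ tableaux n → IsStandard t
      standard t∈ with σ , σ↭ , refl ← ∈-tableaux⁻ n t∈ = P-standard (≤-trans 1≤|t″| (m≤n+m _ j)) σ↭

    combS-combination : ∀ w → combS combination w ≈ Σ-list (map (λ t → coefficient t * S t w) (tableaux n))
    combS-combination w = ≈-reflexive (cong Σ-list (sym (map-∘ (tableaux n))))

    term : Word → ℕ → Carrier
    term w i = S t′ (take (suc i) w) * S t″ (drop i w)

    term-zero : ∀ {i} w → i < length w → i ≢ j → term w i ≈ 0#
    term-zero {i} w i<|w| i≢j = *-zeroˡ _ (S-length t′ (take (suc i) w) λ |u|≡ →
      i≢j (suc-injective (trans (sym (length-take-suc w i<|w|)) (trans |u|≡ |t′|≡))))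

    -- The first factor has the right length only for `i = j`, and then the second one has length
    -- `length w - j`, which differs from `size t″`.
    term-zero′ : ∀ {i} w → length w ≢ n → i < length w → term w i ≈ 0#
    term-zero′ {i} w |w|≢n i<|w| with i ≟ j
    ... | no  i≢j  = term-zero w i<|w| i≢j
    ... | yes refl = *-zeroʳ _ (S-length t″ (drop i w) λ |v|≡ → |w|≢n
      (trans (sym (m+[n∸m]≡n (<⇒≤ i<|w|))) (cong (i +_) (trans (sym (length-drop i w)) |v|≡))))

    prefix-coefficient : ∀ w → j < length w →
      S t′ (take (suc j) w) ≈ indicatorP t′ (filter (_<? suc (suc j)) (reading (P (sortedPositions 1 w))))
    prefix-coefficient w j<|w| = begin
      S t′ u
        ≈⟨ S≈indicatorP t′ u ⟩
      indicatorP t′ (sortedPositions 1 u)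
        ≡⟨ cong (indicatorP t′) (sym restrict) ⟩
      indicatorP t′ (filter Q? σ)
        ≈⟨ indicatorP-∼ t′ (filter Q? σ) (filter Q? (reading (P σ)))
             (filter-∼ Q? (λ _ y≤z _ z<m → ≤-<-trans y≤z z<m) (reading-P σ)) ⟩
      indicatorP t′ (filter Q? (reading (P σ))) ∎
      where
      u = take (suc j) w
      σ = sortedPositions 1 w
      -- Positions count from 1, so the prefix of length `j + 1` occupies those below `j + 2`.
      Q? = _<? suc (suc j)
      restrict : filter Q? σ ≡ sortedPositions 1 u
      restrict = trans (cong (filter Q? ∘ sortedPositions 1) (sym (take++drop≡id (suc j) w)))
        (sortedPositions-prefix 1 u (drop (suc j) w) (cong suc (length-take-suc w j<|w|)))

    suffix-coefficient : ∀ w → j < length w →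
      S t″ (drop j w) ≈ indicatorP (shift j t″) (filter (suc j ≤?_) (reading (P (sortedPositions 1 w))))
    suffix-coefficient w j<|w| = begin
      S t″ v
        ≈⟨ S≈indicatorP t″ v ⟩
      indicatorP t″ (sortedPositions 1 v)
        ≈⟨ shifted ⟩
      indicatorP (shift j t″) (filter Q? σ)
        ≈⟨ indicatorP-∼ (shift j t″) (filter Q? σ) (filter Q? (reading (P σ)))
             (filter-∼ Q? (λ x≤y _ m≤x _ → ≤-trans m≤x x≤y) (reading-P σ)) ⟩
      indicatorP (shift j t″) (filter Q? (reading (P σ))) ∎
      where
      u = take j w
      v = drop j w
      σ = sortedPositions 1 w
      Q? = suc j ≤?_
      restrict : filter Q? σ ≡ map (j +_) (sortedPositions 1 v)
      restrict = trans (cong (filter Q? ∘ sortedPositions 1) (sym (take++drop≡id j w)))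
        (trans (sortedPositions-suffix 1 u v (cong suc (trans (length-take j w) (m≤n⇒m⊓n≡m (<⇒≤ j<|w|)))))
        (sym (trans (sortedPositions-shift j 1 v) (cong (λ i → sortedPositions i v) (+-comm j 1)))))
      P-restrict : P (filter Q? σ) ≡ shift j (P (sortedPositions 1 v))
      P-restrict = trans (cong P restrict) (P-shift j (sortedPositions 1 v))
      shifted : indicatorP t″ (sortedPositions 1 v) ≈ indicatorP (shift j t″) (filter Q? σ)
      shifted = indicatorP-cong t″ (shift j t″) (sortedPositions 1 v) (filter Q? σ)
        (λ P≡ → trans P-restrict (cong (shift j) P≡))
        (λ P≡ → shift-injective j (trans (sym P-restrict) P≡))

    -- At a word of length `n`, each side has one surviving term: the cut at index `j` on the left,
    -- the insertion tableau of the sorted positions on the right. At other lengths both sides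
    -- vanish.
    product≈combination : ∀ w → (S t′ # S t″) w ≈ combS combination w
    product≈combination w with length w ≟ n
    ... | no |w|≢n = begin
      (S t′ # S t″) w
        ≈⟨ Σ-list-zero (term w) (upTo (length w)) (term-zero′ w |w|≢n ∘ ∈-upTo⁻) ⟩
      0#
        ≈⟨ Σ-list-zero _ (tableaux n)
             (λ {t} t∈ → *-zeroʳ _ (S-length t w λ |w|≡ → |w|≢n (trans |w|≡ (size-tableaux n t∈)))) ⟨
      Σ-list (map (λ t → coefficient t * S t w) (tableaux n))
        ≈⟨ combS-combination w ⟨
      combS combination w ∎
    ... | yes |w|≡n = begin
      (S t′ # S t″) w
        ≈⟨ Σ-list-single (term w) (Unique.upTo⁺ (length w)) (∈-upTo⁺ j<|w|)
             (λ i∈ → term-zero w (∈-upTo⁻ i∈)) ⟩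
      S t′ (take (suc j) w) * S t″ (drop j w)
        ≈⟨ *-cong (prefix-coefficient w j<|w|) (suffix-coefficient w j<|w|) ⟩
      coefficient t
        ≈⟨ ≈-trans (*-congˡ (≈-trans (S≈indicatorP t w) (indicatorP-P (sortedPositions 1 w)))) (*-identityʳ _) ⟨
      coefficient t * S t w
        ≈⟨ Σ-list-single (λ t → coefficient t * S t w) (tableaux-unique n)
             (P-∈-tableaux (subst (λ k → sortedPositions 1 w ↭ oneTo k) |w|≡n (sortedPositions-↭-oneTo w)))
             (λ {s} s∈ s≢t → *-zeroʳ _
               (≈-trans (S≈indicatorP s w) (indicatorP-≢ s (sortedPositions 1 w) (s≢t ∘ sym)))) ⟨
      Σ-list (map (λ t → coefficient t * S t w) (tableaux n))
        ≈⟨ combS-combination w ⟨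
      combS combination w ∎
      where
      t : Tableau
      t = P (sortedPositions 1 w)
      -- As `t″` is nonempty, the index `j` does occur in the sum over cuts.
      j<|w| : j < length w
      j<|w| = subst (j <_) (sym |w|≡n) (m<m+n j 1≤|t″|)

theorem4p11 : ∀ {c ℓ : Level} (K : Field c ℓ) (t′ t″ : Tableau) →
    IsStandard t′ → IsStandard t″ →
    Series.InFSym K (Series._#_ K (Series.S K t′) (Series.S K t″))
theorem4p11 K t′ t″ st′ st″ =
  combination t′ t″ j |t′|≡ 1≤|t″| , combination-standard t′ t″ j |t′|≡ 1≤|t″| ,
  product≈combination t′ t″ j |t′|≡ 1≤|t″|
  where
  open Product K
  j = pred (size t′)
  |t′|≡ : size t′ ≡ suc j
  |t′|≡ = sym (suc-pred (size t′) {{>-nonZero (IsStandard.sizePos st′)}})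
  1≤|t″| = IsStandard.sizePos st″
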